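{- Let $L$ be a (classical first-order) signature and let $\varphi$ be a Palyutin formula in $L$. Then: (a) $\varphi$ is equivalent to a Horn formula; (b) for every Horn formula $\psi$, the formula $\varphi \rightarrow \psi$ is equivalent to a Horn formula.
   Context: Classical first-order logic with equality; structures are nonempty; equivalent means logically equivalent. The constants $\top,\bot$ are allowed as formulas and count as atomic formulas. Horn formulas: the smallest set of first-order formulas such that (1) every formula $\beta_1 \wedge \dots \wedge \beta_n \rightarrow \alpha$ with $n \geq 0$ and $\alpha,\beta_1,\dots,\beta_n$ atomic formulas (possibly $\alpha=\bot$) is a Horn formula; (2) the set is closed under conjunction and both quantifiers $\forall$ and $\exists$. Palyutin formulas: the smallest set of first-order formulas such that (1) it contains $\top$, $\bot$ and all atomic formulas; (2) it is closed under conjunction, existential quantification and universal quantification; (3) if $\varphi,\psi$ are Palyutin formulas and $x$ is any variable, then $(\exists x\,\varphi) \wedge \forall x\,(\varphi \rightarrow \psi)$ is a Palyutin formula. -}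

module Defs where

open import Data.Empty.Polymorphic using (⊥)
open import Data.Fin.Base using (Fin)
open import Data.List.Base using (List; []; _∷_)
open import Data.List.Relation.Unary.All using (All)
open import Data.Nat.Base using (ℕ; suc)
open import Data.Product.Base using (_×_; Σ-syntax)
open import Data.Sum.Base using (_⊎_)
open import Data.Unit.Polymorphic using (⊤)
open import Data.Vec.Base using (Vec; []; _∷_; lookup)
open import Function.Bundles using (_⇔_)
open import Level using (Level; _⊔_) renaming (suc to lsuc)
open import Relation.Binary.PropositionalEquality.Core using (_≡_)
open import Relation.Nullary.Negation.Core using (¬_)

infix  8 _≈′_
infixr 6 _∧′_
infixr 5 _∨′_
infixr 4 _⇒′_

private
  variable
    f r : Level

-- Symbols are indexed by their arity; constants are the 0-ary functions.
record Signature (f r : Level) : Set (lsuc (f ⊔ r)) where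
  field
    Fun : ℕ → Set f
    Rel : ℕ → Set r

open Signature public

-- Terms and formulas are well-scoped de Bruijn syntax: the index n bounds the
-- free variables, and a quantifier binds variable zero of its body.
data Term (L : Signature f r) (n : ℕ) : Set f where
  var : Fin n → Term L n
  app : ∀ {k} → Fun L k → Vec (Term L n) k → Term L n

data Formula (L : Signature f r) (n : ℕ) : Set (f ⊔ r) where
  ⊤′ ⊥′          : Formula L n
  _≈′_           : Term L n → Term L n → Formula L n
  rel            : ∀ {k} → Rel L k → Vec (Term L n) k → Formula L n
  ¬′_            : Formula L n → Formula L n
  _∧′_ _∨′_ _⇒′_ : Formula L n → Formula L n → Formula L n
  ∀′_ ∃′_        : Formula L (suc n) → Formula L n

infix 7 ¬′_ ∀′_ ∃′_

record Structure {f r : Level} (L : Signature f r) (ℓ : Level) :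
                 Set (f ⊔ r ⊔ lsuc ℓ) where
  field
    Carrier  : Set ℓ
    nonempty : Carrier
    fun      : ∀ {k} → Fun L k → Vec Carrier k → Carrier
    holds    : ∀ {k} → Rel L k → Vec Carrier k → Set ℓ

module _ {f r ℓ : Level} {L : Signature f r} (M : Structure L ℓ) where
  open Structure M

  mutual
    eval : ∀ {n} → Vec Carrier n → Term L n → Carrier
    eval v (var i)    = lookup v i
    eval v (app g ts) = fun g (evals v ts)

    evals : ∀ {n k} → Vec Carrier n → Vec (Term L n) k → Vec Carrier k
    evals v []       = []
    evals v (t ∷ ts) = eval v t ∷ evals v ts

  -- Tarskian satisfaction.  It is classical only in the presence of
  -- ExcludedMiddle ℓ.
  Sat : ∀ {n} → Vec Carrier n → Formula L n → Set ℓ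
  Sat v ⊤′         = ⊤
  Sat v ⊥′         = ⊥
  Sat v (s ≈′ t)   = eval v s ≡ eval v t
  Sat v (rel R ts) = holds R (evals v ts)
  Sat v (¬′ φ)     = ¬ Sat v φ
  Sat v (φ ∧′ ψ)   = Sat v φ × Sat v ψ
  Sat v (φ ∨′ ψ)   = Sat v φ ⊎ Sat v ψ
  Sat v (φ ⇒′ ψ)   = Sat v φ → Sat v ψ
  Sat v (∀′ φ)     = (a : Carrier) → Sat (a ∷ v) φ
  Sat v (∃′ φ)     = Σ[ a ∈ Carrier ] Sat (a ∷ v) φ

Equivalent : ∀ {f r} (ℓ : Level) {L : Signature f r} {n : ℕ} →
             Formula L n → Formula L n → Set (f ⊔ r ⊔ lsuc ℓ)
Equivalent ℓ {L} {n} φ ψ =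
  (M : Structure L ℓ) (v : Vec (Structure.Carrier M) n) → Sat M v φ ⇔ Sat M v ψ

module _ {f r : Level} {L : Signature f r} where

  data Atomic {n : ℕ} : Formula L n → Set (f ⊔ r) where
    ⊤-atomic   : Atomic ⊤′
    ⊥-atomic   : Atomic ⊥′
    ≈-atomic   : ∀ s t → Atomic (s ≈′ t)
    rel-atomic : ∀ {k} (R : Rel L k) ts → Atomic (rel R ts)

  infixr 4 _⇒*_

  ⋀⁺ : ∀ {n} → Formula L n → List (Formula L n) → Formula L n
  ⋀⁺ β []       = β
  ⋀⁺ β (γ ∷ βs) = β ∧′ ⋀⁺ γ βs

  -- The clause β₁ ∧ … ∧ βₙ → α, which for n = 0 is α itself.
  _⇒*_ : ∀ {n} → List (Formula L n) → Formula L n → Formula L n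
  []       ⇒* α = α
  (β ∷ βs) ⇒* α = ⋀⁺ β βs ⇒′ α

  data Horn {n : ℕ} : Formula L n → Set (f ⊔ r) where
    clause : ∀ {βs α} → All Atomic βs → Atomic α → Horn (βs ⇒* α)
    conj   : ∀ {φ ψ} → Horn φ → Horn ψ → Horn (φ ∧′ ψ)
    univ   : ∀ {φ} → Horn φ → Horn (∀′ φ)
    exis   : ∀ {φ} → Horn φ → Horn (∃′ φ)

  data Palyutin {n : ℕ} : Formula L n → Set (f ⊔ r) where
    atom    : ∀ {φ} → Atomic φ → Palyutin φ
    conj    : ∀ {φ ψ} → Palyutin φ → Palyutin ψ → Palyutin (φ ∧′ ψ)
    exis    : ∀ {φ} → Palyutin φ → Palyutin (∃′ φ)
    univ    : ∀ {φ} → Palyutin φ → Palyutin (∀′ φ)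
    guarded : ∀ {φ ψ} → Palyutin φ → Palyutin ψ →
              Palyutin ((∃′ φ) ∧′ (∀′ (φ ⇒′ ψ)))

{-# OPTIONS --safe #-}

-- Both parts go by simultaneous induction on the Palyutin formula φ.  In (b)
-- a quantifier in front of φ is moved out of φ → ψ as its dual, which is
-- classical for ∀.  The key case is the guarded one:
-- (∃x φ ∧ ∀x (φ → θ)) → ψ is classically equivalent to
--   ∀y (φ(y) → ∃x (φ(x) ∧ (θ(x) → ψ))),
-- where x is a counterexample to φ → θ if there is one, and y otherwise.
-- By induction φ(x) and θ(x) → ψ are Horn, and so is every implication from
-- φ(y) to a Horn formula.
module Submission where

open import Defs
open import Axiom.ExcludedMiddle using (ExcludedMiddle)
open import Data.Fin.Base using (Fin; zero; suc; lift)
open import Data.List.Base using (List; []; _∷_; map)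
open import Data.List.Relation.Unary.All using (All; []; _∷_)
open import Data.Nat.Base using (ℕ; suc)
open import Data.Product.Base as Product
  using (_×_; _,_; proj₁; proj₂; Σ-syntax; curry; uncurry)
open import Data.Product.Function.NonDependent.Propositional using (_×-⇔_)
open import Data.Sum.Function.Propositional using (_⊎-⇔_)
open import Data.Vec.Base using (Vec; []; _∷_; lookup)
open import Function.Base using (_∘_; const)
open import Function.Bundles using (_⇔_; mk⇔; module Equivalence)
open import Function.Construct.Composition using (_⇔-∘_)
open import Function.Construct.Identity using (⇔-id)
open import Function.Construct.Symmetry using (⇔-sym)
open import Function.Related.TypeIsomorphisms using (→-cong-⇔; ¬-cong-⇔)
open import Level using (Level; _⊔_) renaming (suc to lsuc)
open import Relation.Binary.PropositionalEquality
  using (_≡_; refl; sym; cong; cong₂; subst)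
open import Relation.Nullary.Decidable.Core using (yes; no; decidable-stable)
open import Relation.Nullary.Negation.Core using (¬_; contradiction)

open Equivalence using (to; from)

private
  variable
    a p q f r ℓ : Level
    m n k : ℕ
    L : Signature f r

-- Congruences and classical quantifier shifts.

∀-cong-⇔ : {A : Set a} {P : A → Set p} {Q : A → Set q} →
           (∀ x → P x ⇔ Q x) → (∀ x → P x) ⇔ (∀ x → Q x)
∀-cong-⇔ e = mk⇔ (λ g x → to (e x) (g x)) (λ g x → from (e x) (g x))

∃-cong-⇔ : {A : Set a} {P : A → Set p} {Q : A → Set q} →
           (∀ x → P x ⇔ Q x) → (Σ[ x ∈ A ] P x) ⇔ (Σ[ x ∈ A ] Q x)
∃-cong-⇔ e = mk⇔ (Product.map₂ (to (e _))) (Product.map₂ (from (e _)))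

≡-cong-⇔ : {A : Set a} {x x′ y y′ : A} →
           x ≡ x′ → y ≡ y′ → (x ≡ y) ⇔ (x′ ≡ y′)
≡-cong-⇔ refl refl = ⇔-id _

module _ (em : ExcludedMiddle ℓ) {A : Set ℓ} (x₀ : A) where

  -- Independence of premise. Deciding `B` tells whether a witness is available; when `B` fails, the
  -- implication is vacuous and the default `x₀` serves.
  →-∃-⇔ : {B : Set ℓ} {P : A → Set ℓ} →
          (B → Σ[ x ∈ A ] P x) ⇔ (Σ[ x ∈ A ] (B → P x))
  →-∃-⇔ {B} {P} = mk⇔ push λ { (x , g) b → x , g b }
    where
    push : (B → Σ[ x ∈ A ] P x) → Σ[ x ∈ A ] (B → P x)
    push g with em {B}
    ... | yes b = Product.map₂ const (g b)
    ... | no ¬b = x₀ , λ b → contradiction b ¬b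

  -- As in the drinker paradox, the witness is a counterexample to `P` if there is one. Otherwise
  -- `P` holds everywhere, so `B` is already true and `x₀` will do.
  ∀-→-⇔ : {P : A → Set ℓ} {B : Set ℓ} →
          ((∀ x → P x) → B) ⇔ (Σ[ x ∈ A ] (P x → B))
  ∀-→-⇔ {P} {B} = mk⇔ push λ { (x , h) g → h (g x) }
    where
    push : ((∀ x → P x) → B) → Σ[ x ∈ A ] (P x → B)
    push h with em {Σ[ x ∈ A ] ¬ P x}
    ... | yes (x , ¬Px) = x , λ Px → contradiction Px ¬Px
    ... | no ¬∃¬P       = x₀ , const (h λ x → decidable-stable em λ ¬Px → ¬∃¬P (x , ¬Px))

guarded-→-⇔ : ExcludedMiddle ℓ → {A : Set ℓ} {P Q : A → Set ℓ} {B : Set ℓ} →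
              ((Σ[ x ∈ A ] P x) × (∀ x → P x → Q x) → B) ⇔
              (∀ y → P y → Σ[ x ∈ A ] (P x × (Q x → B)))
guarded-→-⇔ em {A} {P} {Q} {B} = mk⇔ push pull
  where
  push : ((Σ[ x ∈ A ] P x) × (∀ x → P x → Q x) → B) →
         ∀ y → P y → Σ[ x ∈ A ] (P x × (Q x → B))
  push h y Py with em {Σ[ x ∈ A ] (P x × ¬ Q x)}
  ... | yes (x , Px , ¬Qx) = x , Px , λ Qx → contradiction Qx ¬Qx
  -- With no counterexample the whole guarded premise holds, its existential half by `y` itself, so
  -- `h` gives `B`.
  ... | no ¬∃ = y , Py , const (h ((y , Py) ,
                  λ x Px → decidable-stable em λ ¬Qx → ¬∃ (x , Px , ¬Qx)))

  pull : (∀ y → P y → Σ[ x ∈ A ] (P x × (Q x → B))) →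
         (Σ[ x ∈ A ] P x) × (∀ x → P x → Q x) → B
  -- The existential half of the premise supplies the `y` at which `h` is used.
  pull h ((y , Py) , P⇒Q) with h y Py
  ... | x , Px , Q⇒B = Q⇒B (P⇒Q x Px)

-- Renaming of variables and its effect on satisfaction.

mutual
  renameTerm : (Fin m → Fin n) → Term L m → Term L n
  renameTerm ρ (var i)    = var (ρ i)
  renameTerm ρ (app g ts) = app g (renameTerms ρ ts)

  renameTerms : (Fin m → Fin n) → Vec (Term L m) k → Vec (Term L n) k
  renameTerms ρ []       = []
  renameTerms ρ (t ∷ ts) = renameTerm ρ t ∷ renameTerms ρ ts

rename : (Fin m → Fin n) → Formula L m → Formula L n
rename ρ ⊤′         = ⊤′
rename ρ ⊥′         = ⊥′
rename ρ (s ≈′ t)   = renameTerm ρ s ≈′ renameTerm ρ t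
rename ρ (rel R ts) = rel R (renameTerms ρ ts)
rename ρ (¬′ φ)     = ¬′ rename ρ φ
rename ρ (φ ∧′ ψ)   = rename ρ φ ∧′ rename ρ ψ
rename ρ (φ ∨′ ψ)   = rename ρ φ ∨′ rename ρ ψ
rename ρ (φ ⇒′ ψ)   = rename ρ φ ⇒′ rename ρ ψ
rename ρ (∀′ φ)     = ∀′ rename (lift 1 ρ) φ
rename ρ (∃′ φ)     = ∃′ rename (lift 1 ρ) φ

-- De Bruijn counterpart of the side condition that the bound variable is not free in the formula,
-- as required for moving a quantifier across an implication.
weaken : Formula L n → Formula L (suc n)
weaken = rename suc

module _ {L : Signature f r} (M : Structure L ℓ) where
  open Structure M

  private
    Agree : (Fin m → Fin n) → Vec Carrier m → Vec Carrier n → Set ℓ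
    Agree ρ v w = ∀ i → lookup w (ρ i) ≡ lookup v i

    agree-lift : {ρ : Fin m → Fin n} {v : Vec Carrier m} {w : Vec Carrier n} →
                 Agree ρ v w → ∀ x → Agree (lift 1 ρ) (x ∷ v) (x ∷ w)
    agree-lift e x zero    = refl
    agree-lift e x (suc i) = e i

  mutual
    eval-rename : {ρ : Fin m → Fin n} {v : Vec Carrier m} {w : Vec Carrier n} →
                  Agree ρ v w → ∀ t → eval M w (renameTerm ρ t) ≡ eval M v t
    eval-rename e (var i)    = e i
    eval-rename e (app g ts) = cong (fun g) (evals-rename e ts)

    evals-rename : {ρ : Fin m → Fin n} {v : Vec Carrier m} {w : Vec Carrier n} →
                   Agree ρ v w → (ts : Vec (Term L m) k) →
                   evals M w (renameTerms ρ ts) ≡ evals M v ts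
    evals-rename e []       = refl
    evals-rename e (t ∷ ts) = cong₂ _∷_ (eval-rename e t) (evals-rename e ts)

  Sat-rename : {ρ : Fin m → Fin n} {v : Vec Carrier m} {w : Vec Carrier n} →
               Agree ρ v w → ∀ φ → Sat M w (rename ρ φ) ⇔ Sat M v φ
  Sat-rename e ⊤′         = ⇔-id _
  Sat-rename e ⊥′         = ⇔-id _
  Sat-rename e (s ≈′ t)   = ≡-cong-⇔ (eval-rename e s) (eval-rename e t)
  Sat-rename e (rel R ts) = mk⇔ (subst (holds R) (evals-rename e ts))
                                (subst (holds R) (sym (evals-rename e ts)))
  Sat-rename e (¬′ φ)     = ¬-cong-⇔ (Sat-rename e φ)
  Sat-rename e (φ ∧′ ψ)   = Sat-rename e φ ×-⇔ Sat-rename e ψ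
  Sat-rename e (φ ∨′ ψ)   = Sat-rename e φ ⊎-⇔ Sat-rename e ψ
  Sat-rename e (φ ⇒′ ψ)   = →-cong-⇔ (Sat-rename e φ) (Sat-rename e ψ)
  Sat-rename e (∀′ φ)     = ∀-cong-⇔ λ x → Sat-rename (agree-lift e x) φ
  Sat-rename e (∃′ φ)     = ∃-cong-⇔ λ x → Sat-rename (agree-lift e x) φ

  Sat-weaken : {v : Vec Carrier n} (x : Carrier) (φ : Formula L n) →
               Sat M (x ∷ v) (weaken φ) ⇔ Sat M v φ
  Sat-weaken x = Sat-rename λ i → refl

-- Renaming of Horn formulas.

rename-⋀⁺ : (ρ : Fin m → Fin n) (β : Formula L m) (βs : List (Formula L m)) →
            ⋀⁺ (rename ρ β) (map (rename ρ) βs) ≡ rename ρ (⋀⁺ β βs)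
rename-⋀⁺ ρ β []       = refl
rename-⋀⁺ ρ β (γ ∷ βs) = cong (rename ρ β ∧′_) (rename-⋀⁺ ρ γ βs)

-- For an unknown list of premises `_⇒*_` does not compute, so a renamed clause has the shape of a
-- clause only up to this equality; `rename-horn` transports along it.
rename-⇒* : (ρ : Fin m → Fin n) (βs : List (Formula L m)) (α : Formula L m) →
            (map (rename ρ) βs ⇒* rename ρ α) ≡ rename ρ (βs ⇒* α)
rename-⇒* ρ []       α = refl
rename-⇒* ρ (β ∷ βs) α = cong (_⇒′ rename ρ α) (rename-⋀⁺ ρ β βs)

rename-atomic : (ρ : Fin m → Fin n) {φ : Formula L m} →
                Atomic φ → Atomic (rename ρ φ)
rename-atomic ρ ⊤-atomic          = ⊤-atomic
rename-atomic ρ ⊥-atomic          = ⊥-atomic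
rename-atomic ρ (≈-atomic s t)    = ≈-atomic _ _
rename-atomic ρ (rel-atomic R ts) = rel-atomic R _

rename-allAtomic : (ρ : Fin m → Fin n) {βs : List (Formula L m)} →
                   All Atomic βs → All Atomic (map (rename ρ) βs)
rename-allAtomic ρ []       = []
rename-allAtomic ρ (β ∷ βs) = rename-atomic ρ β ∷ rename-allAtomic ρ βs

rename-horn : (ρ : Fin m → Fin n) {φ : Formula L m} → Horn φ → Horn (rename ρ φ)
rename-horn ρ (clause {βs} {α} aβs aα) = subst Horn (rename-⇒* ρ βs α)
  (clause (rename-allAtomic ρ aβs) (rename-atomic ρ aα))
rename-horn ρ (conj h h′) = conj (rename-horn ρ h) (rename-horn ρ h′)
rename-horn ρ (univ h)    = univ (rename-horn (lift 1 ρ) h)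
rename-horn ρ (exis h)    = exis (rename-horn (lift 1 ρ) h)

-- Formulas equivalent to Horn formulas.

record HornDefinable (ℓ : Level) {L : Signature f r} {n : ℕ} (φ : Formula L n) :
                     Set (f ⊔ r ⊔ lsuc ℓ) where
  constructor hornForm
  field
    form       : Formula L n
    horn       : Horn form
    equivalent : Equivalent ℓ φ form

-- Part (b) as a property of φ. Quantifying over ψ inside it lets the induction hypothesis be
-- applied to weakened and to newly built consequents.
HornAntecedent : (ℓ : Level) {L : Signature f r} {n : ℕ} →
                 Formula L n → Set (f ⊔ r ⊔ lsuc ℓ)
HornAntecedent ℓ {L} {n} φ = (ψ : Formula L n) → Horn ψ → HornDefinable ℓ (φ ⇒′ ψ)

module _ {L : Signature f r} where

  horn-def : {φ : Formula L n} → Horn φ → HornDefinable ℓ φ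
  horn-def h = hornForm _ h λ M v → ⇔-id _

  def-resp : {φ ψ : Formula L n} →
             Equivalent ℓ φ ψ → HornDefinable ℓ ψ → HornDefinable ℓ φ
  def-resp e (hornForm χ h e′) = hornForm χ h λ M v → e′ M v ⇔-∘ e M v

  def-∧ : {φ ψ : Formula L n} →
          HornDefinable ℓ φ → HornDefinable ℓ ψ → HornDefinable ℓ (φ ∧′ ψ)
  def-∧ (hornForm χ h e) (hornForm χ′ h′ e′) =
    hornForm (χ ∧′ χ′) (conj h h′) λ M v → e M v ×-⇔ e′ M v

  def-∀ : {φ : Formula L (suc n)} → HornDefinable ℓ φ → HornDefinable ℓ (∀′ φ)
  def-∀ (hornForm χ h e) =
    hornForm (∀′ χ) (univ h) λ M v → ∀-cong-⇔ λ x → e M (x ∷ v)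

  def-∃ : {φ : Formula L (suc n)} → HornDefinable ℓ φ → HornDefinable ℓ (∃′ φ)
  def-∃ (hornForm χ h e) =
    hornForm (∃′ χ) (exis h) λ M v → ∃-cong-⇔ λ x → e M (x ∷ v)

  -- Makes part (b) iterable: the consequent may itself be the outcome of an earlier step, known
  -- only up to equivalence.
  def-⇒ : {φ ψ : Formula L n} →
          HornAntecedent ℓ φ → HornDefinable ℓ ψ → HornDefinable ℓ (φ ⇒′ ψ)
  def-⇒ ant (hornForm χ h e) =
    def-resp (λ M v → →-cong-⇔ (⇔-id _) (e M v)) (ant χ h)

  def-weaken : {φ : Formula L n} → HornDefinable ℓ φ → HornDefinable ℓ (weaken φ)
  def-weaken {φ = φ} (hornForm χ h e) = hornForm (weaken χ) (rename-horn suc h) λ where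
    M (x ∷ v) → ⇔-sym (Sat-weaken M x χ) ⇔-∘ (e M v ⇔-∘ Sat-weaken M x φ)

  -- Implications with a Palyutin antecedent.

  cons-⇒* : (β : Formula L n) (βs : List (Formula L n)) (α : Formula L n) →
            Equivalent ℓ (β ⇒′ (βs ⇒* α)) ((β ∷ βs) ⇒* α)
  -- Without further premises the clause is α itself rather than an implication, so there is nothing
  -- to uncurry.
  cons-⇒* β []       α M v = ⇔-id _
  cons-⇒* β (γ ∷ βs) α M v = mk⇔ uncurry curry

  module _ (em : ExcludedMiddle ℓ) where

    -- Induction on the Horn formula: the atom is pushed inward through conjunctions and quantifiers
    -- until it becomes one more premise of each clause. Passing an ∃ is the classical step and
    -- draws its default element from `nonempty`.
    ant-atomic : {β : Formula L n} → Atomic β → HornAntecedent ℓ β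
    ant-atomic {β = β} aβ _ (clause {βs} {α} aβs aα) =
      def-resp (cons-⇒* β βs α) (horn-def (clause (aβ ∷ aβs) aα))
    ant-atomic aβ _ (conj h h′) =
      def-resp (λ M v → mk⇔ (λ g → proj₁ ∘ g , proj₂ ∘ g) (uncurry Product.<_,_>))
        (def-∧ (ant-atomic aβ _ h) (ant-atomic aβ _ h′))
    ant-atomic {β = β} aβ _ (univ h) =
      def-resp (λ M v → mk⇔ (λ g x b → g (to (Sat-weaken M x β) b) x)
                            (λ g b x → g x (from (Sat-weaken M x β) b)))
        (def-∀ (ant-atomic (rename-atomic suc aβ) _ h))
    ant-atomic {β = β} aβ _ (exis h) =
      def-resp (λ M v → ∃-cong-⇔ (λ x → →-cong-⇔ (⇔-sym (Sat-weaken M x β)) (⇔-id _))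
                        ⇔-∘ →-∃-⇔ em (Structure.nonempty M))
        (def-∃ (ant-atomic (rename-atomic suc aβ) _ h))

    -- Currying reduces the claim to φ → (θ → ψ), whose inner implication is only equivalent to a
    -- Horn formula.
    ant-∧ : {φ θ : Formula L n} →
            HornAntecedent ℓ φ → HornAntecedent ℓ θ → HornAntecedent ℓ (φ ∧′ θ)
    ant-∧ antφ antθ ψ h =
      def-resp (λ M v → mk⇔ curry uncurry) (def-⇒ antφ (antθ ψ h))

    ant-∃ : {φ : Formula L (suc n)} → HornAntecedent ℓ φ → HornAntecedent ℓ (∃′ φ)
    ant-∃ antφ ψ h =
      def-resp (λ M v → mk⇔ (λ g x p → from (Sat-weaken M x ψ) (g (x , p)))
                            (λ { g (x , p) → to (Sat-weaken M x ψ) (g x p) }))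
        (def-∀ (antφ (weaken ψ) (rename-horn suc h)))

    ant-∀ : {φ : Formula L (suc n)} → HornAntecedent ℓ φ → HornAntecedent ℓ (∀′ φ)
    ant-∀ antφ ψ h =
      def-resp (λ M v → ∃-cong-⇔ (λ x → →-cong-⇔ (⇔-id _) (⇔-sym (Sat-weaken M x ψ)))
                        ⇔-∘ ∀-→-⇔ em (Structure.nonempty M))
        (def-∃ (antφ (weaken ψ) (rename-horn suc h)))

    ant-guarded : {φ θ : Formula L (suc n)} →
                  HornDefinable ℓ φ → HornAntecedent ℓ φ → HornAntecedent ℓ θ →
                  HornAntecedent ℓ ((∃′ φ) ∧′ (∀′ (φ ⇒′ θ)))
    ant-guarded {φ = φ} {θ} defφ antφ antθ ψ h =
      def-resp (λ M v →
          ∀-cong-⇔ (λ y → →-cong-⇔ (⇔-id _)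
            (⇔-sym (Sat-weaken M y witness) ⇔-∘
             ∃-cong-⇔ (λ x → ⇔-id _ ×-⇔ →-cong-⇔ (⇔-id _) (⇔-sym (Sat-weaken M x ψ)))))
          ⇔-∘ guarded-→-⇔ em)
        -- The existential statement about x does not mention y, hence the weakening under ∀y. The
        -- same body φ serves as φ(y) and φ(x), variable zero being bound by a different quantifier
        -- each time.
        (def-∀ (def-⇒ antφ (def-weaken
          (def-∃ (def-∧ defφ (antθ (weaken ψ) (rename-horn suc h)))))))
      where witness = ∃′ (φ ∧′ (θ ⇒′ weaken ψ))

    -- The guarded case ties the two parts together: (a) uses (b) for φ to treat φ → θ, while (b)
    -- uses (a) for φ because φ(x) occurs there as a conjunct.
    palyutin-horn : {φ : Formula L n} → Palyutin φ →
                    HornDefinable ℓ φ × HornAntecedent ℓ φ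
    -- An atomic formula is the clause with no premises.
    palyutin-horn (atom a) = horn-def (clause [] a) , ant-atomic a
    palyutin-horn (conj P Q) with palyutin-horn P | palyutin-horn Q
    ... | defφ , antφ | defθ , antθ = def-∧ defφ defθ , ant-∧ antφ antθ
    palyutin-horn (exis P) = Product.map def-∃ ant-∃ (palyutin-horn P)
    palyutin-horn (univ P) = Product.map def-∀ ant-∀ (palyutin-horn P)
    palyutin-horn (guarded P Q) with palyutin-horn P | palyutin-horn Q
    ... | defφ , antφ | defθ , antθ =
      def-∧ (def-∃ defφ) (def-∀ (def-⇒ antφ defθ)) , ant-guarded defφ antφ antθ

theorem1p6 : ∀ {f r ℓ : Level} → ExcludedMiddle ℓ →
    (L : Signature f r) {n : ℕ} (φ : Formula L n) → Palyutin φ →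
    (Σ[ χ ∈ Formula L n ] (Horn χ × Equivalent ℓ φ χ)) ×
    ((ψ : Formula L n) → Horn ψ →
    Σ[ χ ∈ Formula L n ] (Horn χ × Equivalent ℓ (φ ⇒′ ψ) χ))
theorem1p6 {ℓ = ℓ} em L {n} φ P with palyutin-horn em P
... | defφ , antφ = toΣ defφ , λ ψ h → toΣ (antφ ψ h)
  where
  toΣ : {θ : Formula L n} → HornDefinable ℓ θ →
        Σ[ χ ∈ Formula L n ] (Horn χ × Equivalent ℓ θ χ)
  toΣ (hornForm χ h e) = χ , h , e
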